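{- For every odd $n\ge 3$ there exists an integer cyclically $3$-diagonal $\mathrm{H}_n(n;3)$.
   Context: A partially filled (p.f.) array is a matrix in which some cells may be empty. Let $n\ge k\ge 3$, let $t$ divide $2nk$, put $v=2nk+t$ and let $J$ be the subgroup of $\mathbb{Z}_v$ of order $t$. An $\mathrm{H}_t(n;k)$ (square relative Heffter array) is an $n\times n$ p.f. array with elements in $\mathbb{Z}_v$ such that each row and each column has exactly $k$ filled cells; for every $x\in\mathbb{Z}_v\setminus J$ either $x$ or $-x$ appears in the array; and the elements of every row and column sum to $0$. It is integer if moreover the elements of every row and column, viewed as integers in $\pm\{1,\dots,\lfloor\frac{2nk+t}{2}\rfloor\}$, sum to $0$ in $\mathbb{Z}$. For an $n\times n$ array and $i\in\{1,\dots,n\}$, the $i$-th diagonal is $D_i=\{(i,1),(i+1,2),\dots,(i-1,n)\}$, indices taken modulo $n$ in $\{1,\dots,n\}$. Diagonals $D_i,D_{i+1},\dots,D_{i+r}$ (indices mod $n$) are consecutive. A p.f. array of size $n\ge k$ is cyclically $k$-diagonal if its nonempty cells are exactly those of $k$ consecutive diagonals. -}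

module Defs where

open import Data.Bool.Base using (if_then_else_)
open import Data.Fin.Base using (Fin; toℕ)
open import Data.Fin.Properties using (nonZeroIndex)
open import Data.Fin.Subset using (Subset; _∈_; _∉_; ∣_∣)
open import Data.Integer.Base as ℤ using (ℤ; +_; 0ℤ)
open import Data.List.Base using (List; foldr; length; map; tabulate; catMaybes)
open import Data.Maybe using (Maybe; just; Is-just)
open import Data.Nat.Base
open import Data.Nat.DivMod using (_mod_)
open import Data.Nat.Divisibility using (_∣_)
open import Data.Product.Base using (_×_; ∃; ∃-syntax)
open import Data.Sum.Base using (_⊎_)
open import Function.Bundles using (_⇔_)
open import Relation.Binary.PropositionalEquality using (_≡_)

-- The cyclic group ℤ_v, carried by the residues 0, …, v ∸ 1.

module Cyclic (v : ℕ) .{{_ : NonZero v}} where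

  infixl 6 _⊕_
  infix  8 ⊖_

  𝟘 : Fin v
  𝟘 = 0 mod v

  _⊕_ : Fin v → Fin v → Fin v
  x ⊕ y = (toℕ x + toℕ y) mod v

  ⊖_ : Fin v → Fin v
  ⊖ x = (v ∸ toℕ x) mod v

  sum : List (Fin v) → Fin v
  sum = foldr _⊕_ 𝟘

  record IsSubgroup (J : Subset v) : Set where
    field
      𝟘-mem    : 𝟘 ∈ J
      ⊕-closed : ∀ {x y} → x ∈ J → y ∈ J → x ⊕ y ∈ J
      ⊖-closed : ∀ {x} → x ∈ J → ⊖ x ∈ J

-- The representative of a nonzero residue in ±{1, …, ⌊v/2⌋}. The residue v/2
-- for even v, which has two, is sent to + v/2; it cannot occur in a relative
-- Heffter array, since it then lies in J, and neither can 0.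

signed : ∀ {v} → Fin v → ℤ
signed {v} x = if toℕ x ≤ᵇ v / 2 then + toℕ x else toℕ x ℤ.⊖ v

sumℤ : List ℤ → ℤ
sumℤ = foldr ℤ._+_ 0ℤ

-- An n × n partially filled array, `nothing` marking an empty cell.

PFArray : Set → ℕ → Set
PFArray X n = Fin n → Fin n → Maybe X

module _ {X : Set} {n : ℕ} where

  elements : (Fin n → Maybe X) → List X
  elements line = catMaybes (tabulate line)

  EveryLine : (List X → Set) → PFArray X n → Set
  EveryLine P A =
    (∀ i → P (elements (λ j → A i j))) × (∀ j → P (elements (λ i → A i j)))

  Appears : X → PFArray X n → Set
  Appears x A = ∃[ i ] ∃[ j ] A i j ≡ just x

modulus : (t n k : ℕ) → ℕ
modulus t n k = 2 * n * k + t

modulus≢0 : ∀ t {n k} → 3 ≤ k → k ≤ n → NonZero (modulus t n k)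
modulus≢0 t {suc _} {suc _} _ _ = _
modulus≢0 t {zero}  {suc _} _ ()

-- The predicate that A is an H_t(n;k). A finite cyclic group has exactly one
-- subgroup of each order dividing its own, so J is determined by its fields.
-- "Either x or -x appears" is not exclusive as written, but exclusivity follows
-- by counting: the nk filled cells must meet all nk pairs {x , -x} outside J.

record IsRelativeHeffter (t n k : ℕ) (A : PFArray (Fin (modulus t n k)) n) : Set where
  field
    3≤k   : 3 ≤ k
    k≤n   : k ≤ n
    t∣2nk : t ∣ 2 * n * k

  open Cyclic (modulus t n k) {{modulus≢0 t 3≤k k≤n}}

  field
    J          : Subset (modulus t n k)
    J-subgroup : IsSubgroup J
    J-order    : ∣ J ∣ ≡ t
    filled     : EveryLine (λ xs → length xs ≡ k) A
    support    : ∀ x → x ∉ J → Appears x A ⊎ Appears (⊖ x) A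
    zero-sum   : EveryLine (λ xs → sum xs ≡ 𝟘) A

IsInteger : ∀ {v n} → PFArray (Fin v) n → Set
IsInteger = EveryLine (λ xs → sumℤ (map signed xs) ≡ 0ℤ)

-- Rows, columns and diagonals are numbered from 0, so D_i consists of the
-- cells (i + c mod n , c); the index i may be any natural number, read mod n.

OnDiagonal : ∀ {n} → ℕ → Fin n → Fin n → Set
OnDiagonal {n} i r c = r ≡ ((i + toℕ c) mod n) {{nonZeroIndex r}}

IsCyclicallyDiagonal : ∀ {X n} → ℕ → PFArray X n → Set
IsCyclicallyDiagonal {n = n} k A =
  k ≤ n ×
  ∃[ i ] ∀ r c → Is-just (A r c) ⇔ (∃ λ (s : Fin k) → OnDiagonal (i + toℕ s) r c)

{-# OPTIONS --safe #-}
module Submission where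

-- Let n = 2m + 1, so that v = 7n and J = 7ℤ_v. The residues outside J that are
-- 1, 2 or 4 mod 7 form exactly one of x, -x for each pair, and their integer
-- representatives are the numbers 7j + 1, 7j + 2 and 7j - 3 with -m ≤ j ≤ m. Each
-- of these three classes fills one diagonal; since 1 + 2 - 3 = 0, only the
-- multipliers j have to sum to zero on every line. Both outer diagonals carry the
-- cyclic sequence 0, -m, 1, -m + 1, 2, …, -1, m, whose adjacent sums, read
-- cyclically, are -m, -m + 1, …, m in this order, and the middle diagonal carries
-- the negatives of these sums.

open import Defs
open import Data.Bool.Base using (true; false)
open import Data.Fin.Base using (Fin; zero; suc; toℕ; fromℕ<)
open import Data.Fin.Properties
  using (_≟_; toℕ<n; toℕ-injective; toℕ-fromℕ<; all?)
open import Data.Fin.Subset using (Subset; _∈_; ∣_∣)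
open import Data.Integer.Base as ℤ using (ℤ; +_; 0ℤ)
open import Data.Integer.Divisibility.Signed as ℤ using (divides)
import Data.Integer.Properties as ℤ
import Data.Integer.Tactic.RingSolver as ℤ-Solver
open import Data.List.Base using (List; []; _∷_; map; length)
open import Data.List.Relation.Binary.Permutation.Propositional
  using (_↭_; ↭-refl; ↭-trans; ↭-swap; prep; ↭⇒↭ₛ)
open import Data.List.Relation.Binary.Permutation.Propositional.Properties
  using (↭-length; map⁺)
import Data.List.Relation.Binary.Permutation.Setoid.Properties as Permutationₛ
open import Data.Maybe using (Maybe; just; nothing; Is-just)
open import Data.Maybe.Relation.Unary.Any using (just)
open import Data.Nat.Base
open import Data.Nat.Divisibility
open import Data.Nat.DivMod
open import Data.Nat.Properties as ℕ hiding (_≟_)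
open import Data.Nat.Tactic.RingSolver using (solve-∀)
open import Data.Product.Base using (Σ; ∃; ∃-syntax; _×_; _,_; proj₁; proj₂)
open import Data.Sum.Base as Sum using (_⊎_; inj₁; inj₂; [_,_]′)
open import Data.Unit.Base using (tt)
open import Data.Vec.Base using (tabulate)
open import Data.Vec.Properties using (lookup⇒[]=; []=⇒lookup; lookup∘tabulate)
open import Data.Vec.Functional using (updateAt)
open import Data.Vec.Functional.Properties using (updateAt-updates; updateAt-minimal)
open import Function.Base using (_∘_; const)
open import Function.Bundles using (mk⇔)
open import Relation.Binary.PropositionalEquality
open import Relation.Nullary.Decidable
  using (Dec; does; yes; no; toWitness; does-⇔; dec-true; _→-dec_; _⊎-dec_)
open import Relation.Nullary.Negation using (¬_; contradiction)
open import Relation.Nullary.Reflects using (invert)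

-- Residues

toℕ-mod : ∀ a n .{{_ : NonZero n}} → toℕ (a mod n) ≡ a % n
toℕ-mod a n = toℕ-fromℕ< (m%n<n a n)

[m+n%d]%d≡[m+n]%d : ∀ m n d .{{_ : NonZero d}} → (m + n % d) % d ≡ (m + n) % d
[m+n%d]%d≡[m+n]%d m n d = begin
  (m + n % d) % d          ≡⟨ %-distribˡ-+ m (n % d) d ⟩
  (m % d + n % d % d) % d  ≡⟨ cong (λ r → (m % d + r) % d) (m%n%n≡m%n n d) ⟩
  (m % d + n % d) % d      ≡⟨ %-distribˡ-+ m n d ⟨
  (m + n) % d              ∎
  where open ≡-Reasoning

m+m≡m*2 : ∀ m → m + m ≡ m * 2
m+m≡m*2 = solve-∀

module _ {n : ℕ} .{{_ : NonZero n}} where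

  shift : ℕ → Fin n → Fin n
  shift k c = (k + toℕ c) mod n

  shift-∘ : ∀ k l c → shift k (shift l c) ≡ shift (k + l) c
  shift-∘ k l c = toℕ-injective (begin
    toℕ (shift k (shift l c))    ≡⟨ toℕ-mod (k + toℕ (shift l c)) n ⟩
    (k + toℕ (shift l c)) % n    ≡⟨ cong (λ r → (k + r) % n) (toℕ-mod (l + toℕ c) n) ⟩
    (k + (l + toℕ c) % n) % n    ≡⟨ [m+n%d]%d≡[m+n]%d k (l + toℕ c) n ⟩
    (k + (l + toℕ c)) % n        ≡⟨ %-congˡ (+-assoc k l (toℕ c)) ⟨
    (k + l + toℕ c) % n          ≡⟨ toℕ-mod (k + l + toℕ c) n ⟨
    toℕ (shift (k + l) c)        ∎)
    where open ≡-Reasoning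

  shift-period : ∀ c → shift n c ≡ c
  shift-period c = toℕ-injective (begin
    toℕ (shift n c)    ≡⟨ toℕ-mod (n + toℕ c) n ⟩
    (n + toℕ c) % n    ≡⟨ %-remove-+ˡ (toℕ c) ∣-refl ⟩
    toℕ c % n          ≡⟨ m<n⇒m%n≡m (toℕ<n c) ⟩
    toℕ c              ∎)
    where open ≡-Reasoning

  -- A fixed point would make `k` the quotient term `q * n` in the division of `k + toℕ c` by `n`,
  -- but no multiple of `n` lies strictly between 0 and `n`.
  shift-moves : ∀ {k} c → 0 < k → k < n → shift k c ≢ c
  shift-moves {k} c 0<k k<n eq = >⇒∤ {{>-nonZero 0<k}} k<n (divides ((k + toℕ c) / n) k≡qn)
    where
    open ≡-Reasoning
    q = (k + toℕ c) / n
    k≡qn : k ≡ q * n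
    k≡qn = +-cancelʳ-≡ (toℕ c) k (q * n) (begin
      k + toℕ c                  ≡⟨ m≡m%n+[m/n]*n (k + toℕ c) n ⟩
      (k + toℕ c) % n + q * n    ≡⟨ cong (_+ q * n) (toℕ-mod (k + toℕ c) n) ⟨
      toℕ (shift k c) + q * n    ≡⟨ cong (λ x → toℕ x + q * n) eq ⟩
      toℕ c + q * n              ≡⟨ +-comm (toℕ c) (q * n) ⟩
      q * n + toℕ c              ∎)

-- Multiples of a divisor as a subgroup

module _ (d : ℕ) where

  multiples : ∀ v → Subset v
  multiples v = tabulate λ x → does (d ∣? toℕ x)

  ∈-multiples⁺ : ∀ {v} {x : Fin v} → d ∣ toℕ x → x ∈ multiples v
  ∈-multiples⁺ {x = x} d∣x = lookup⇒[]= x _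
    (trans (lookup∘tabulate _ x) (dec-true (d ∣? toℕ x) d∣x))

  ∈-multiples⁻ : ∀ {v} {x : Fin v} → x ∈ multiples v → d ∣ toℕ x
  ∈-multiples⁻ {x = x} x∈ with d ∣? toℕ x | trans (sym (lookup∘tabulate _ x)) ([]=⇒lookup x∈)
  ... | yes d∣x | _  = d∣x
  ... | no  _   | ()

  module _ {v : ℕ} .{{_ : NonZero v}} (d∣v : d ∣ v) where

    open Cyclic v

    -- Because `d` divides `v`, reduction modulo `v` preserves divisibility by `d`; closure can then
    -- be checked on natural numbers before reduction.
    mod-∣ : ∀ {a} → d ∣ a → a mod v ∈ multiples v
    mod-∣ {a} d∣a = ∈-multiples⁺ (subst (d ∣_) (sym (toℕ-mod a v)) (%-presˡ-∣ d∣a d∣v))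

    multiples-isSubgroup : IsSubgroup (multiples v)
    multiples-isSubgroup = record
      { 𝟘-mem    = mod-∣ (d ∣0)
      ; ⊕-closed = λ x∈ y∈ → mod-∣ (∣m∣n⇒∣m+n (∈-multiples⁻ x∈) (∈-multiples⁻ y∈))
      ; ⊖-closed = λ {x} x∈ → mod-∣ (∣m+n∣m⇒∣n
          (subst (d ∣_) (sym (m+[n∸m]≡n (<⇒≤ (toℕ<n x)))) d∣v) (∈-multiples⁻ x∈))
      }

-- Integer representatives

sumℤ-↭ : ∀ {xs ys} → xs ↭ ys → sumℤ xs ≡ sumℤ ys
sumℤ-↭ xs↭ys = Permutationₛ.foldr-commMonoid (setoid ℤ)
  ℤ.+-0-isCommutativeMonoid (↭⇒↭ₛ xs↭ys)

signed-congruent : ∀ {v} (x : Fin v) → + v ℤ.∣ signed x ℤ.- + toℕ x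
signed-congruent {v} x with toℕ x ≤ᵇ v / 2
... | true  = divides 0ℤ (ℤ.+-inverseʳ (+ toℕ x))
... | false = divides (ℤ.- + 1) (begin
  toℕ x ℤ.⊖ v ℤ.- + toℕ x           ≡⟨ cong (ℤ._- + toℕ x) (ℤ.m-n≡m⊖n (toℕ x) v) ⟨
  + toℕ x ℤ.- + v ℤ.- + toℕ x       ≡⟨ cancel (+ toℕ x) (+ v) ⟩
  ℤ.- + 1 ℤ.* + v                   ∎)
  where
  open ≡-Reasoning
  cancel : ∀ a b → a ℤ.- b ℤ.- a ≡ ℤ.- + 1 ℤ.* b
  cancel = ℤ-Solver.solve-∀

mod-congruent : ∀ a n .{{_ : NonZero n}} → + n ℤ.∣ + a ℤ.- + (a % n)
mod-congruent a n = divides (+ (a / n)) (begin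
  + a ℤ.- + (a % n)                            ≡⟨ cong (λ b → + b ℤ.- + (a % n)) (m≡m%n+[m/n]*n a n) ⟩
  + (a % n) ℤ.+ + (a / n * n) ℤ.- + (a % n)    ≡⟨ cancel (+ (a % n)) (+ (a / n * n)) ⟩
  + (a / n * n)                                ≡⟨ ℤ.pos-* (a / n) n ⟩
  + (a / n) ℤ.* + n                            ∎)
  where
  open ≡-Reasoning
  cancel : ∀ r q → r ℤ.+ q ℤ.- r ≡ q
  cancel = ℤ-Solver.solve-∀

module _ {v : ℕ} .{{_ : NonZero v}} where

  open Cyclic v

  sumℤ-congruent : ∀ xs → + v ℤ.∣ sumℤ (map signed xs) ℤ.- + toℕ (sum xs)
  sumℤ-congruent [] = subst (λ r → + v ℤ.∣ 0ℤ ℤ.- + r)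
    (sym (trans (toℕ-mod 0 v) (m<n⇒m%n≡m (>-nonZero⁻¹ v)))) (divides 0ℤ refl)
  sumℤ-congruent (x ∷ xs) =
    subst (+ v ℤ.∣_) (regroup (signed x) (sumℤ (map signed xs))
                       (+ toℕ x) (+ toℕ (sum xs)) (+ toℕ (x ⊕ sum xs)))
      (ℤ.∣m∣n⇒∣m+n (ℤ.∣m∣n⇒∣m+n (signed-congruent x) (sumℤ-congruent xs))
        (subst (λ r → + v ℤ.∣ + toℕ x ℤ.+ + toℕ (sum xs) ℤ.- + r)
          (sym (toℕ-mod (toℕ x + toℕ (sum xs)) v)) (mod-congruent (toℕ x + toℕ (sum xs)) v)))
    where
    regroup : ∀ s S a b c → s ℤ.- a ℤ.+ (S ℤ.- b) ℤ.+ (a ℤ.+ b ℤ.- c) ≡ s ℤ.+ S ℤ.- c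
    regroup = ℤ-Solver.solve-∀

  -- The integer sum and the residue sum agree modulo `v`, so `v` divides a representative smaller
  -- than `v`. Thus the integer condition on a line already gives the cyclic one.
  sumℤ≡0⇒sum≡𝟘 : ∀ xs → sumℤ (map signed xs) ≡ 0ℤ → sum xs ≡ 𝟘
  sumℤ≡0⇒sum≡𝟘 xs eq = toℕ-injective (begin
    toℕ (sum xs)       ≡⟨ m<n⇒m%n≡m (toℕ<n (sum xs)) ⟨
    toℕ (sum xs) % v   ≡⟨ n∣m⇒m%n≡0 (toℕ (sum xs)) v v∣sum ⟩
    0                  ≡⟨ m<n⇒m%n≡m (>-nonZero⁻¹ v) ⟨
    0 % v              ≡⟨ toℕ-mod 0 v ⟨
    toℕ 𝟘              ∎)
    where
    open ≡-Reasoning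
    v∣sum : v ∣ toℕ (sum xs)
    v∣sum = subst (v ∣_) (ℤ.∣-i∣≡∣i∣ (+ toℕ (sum xs)))
      (ℤ.∣⇒∣ᵤ (subst (+ v ℤ.∣_)
        (trans (cong (ℤ._- + toℕ (sum xs)) eq) (ℤ.+-identityˡ (ℤ.- + toℕ (sum xs)))) (sumℤ-congruent xs)))

-- The order of the subgroup of multiples of 7

∣multiples-7∣ : ∀ k → ∣ multiples 7 (k * 7) ∣ ≡ k
∣multiples-7∣ k = go k _ λ _ → refl
  where
  periodic : ∀ x → does (7 ∣? (7 + x)) ≡ does (7 ∣? x)
  periodic x = does-⇔ (mk⇔ (λ p → ∣m+n∣m⇒∣n p ∣-refl) (∣m∣n⇒∣m+n ∣-refl)) (7 ∣? (7 + x)) (7 ∣? x)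

  -- Each block of seven residues contributes its first member only. The indicator is generalised to
  -- any `g` that agrees with it pointwise, so that after one block the shifted function is again
  -- admissible by `periodic`.
  go : ∀ k g → (∀ x → g x ≡ does (7 ∣? x)) → ∣ tabulate {n = k * 7} (g ∘ toℕ) ∣ ≡ k
  go zero    g g≗ = refl
  go (suc k) g g≗
    rewrite g≗ 0 | g≗ 1 | g≗ 2 | g≗ 3 | g≗ 4 | g≗ 5 | g≗ 6
    = cong suc (go k (λ x → g (7 + x)) λ x → trans (g≗ (7 + x)) (periodic x))

-- Lines with three filled cells

module _ {X : Set} where

  -- Cells are extracted up to permutation because the order in which a line meets the three
  -- diagonals depends on where they wrap around. Blanking the extracted cell lets the argument be
  -- repeated on the rest.
  elements-remove : ∀ {n} (f : Fin n → Maybe X) i {x} → f i ≡ just x →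
                    elements f ↭ x ∷ elements (updateAt f i (const nothing))
  elements-remove f zero    eq rewrite eq = ↭-refl
  elements-remove f (suc i) eq with f zero
  ... | nothing = elements-remove (f ∘ suc) i eq
  ... | just y  = ↭-trans (prep y (elements-remove (f ∘ suc) i eq)) (↭-swap y _ ↭-refl)

  elements-empty : ∀ {n} (f : Fin n → Maybe X) → (∀ i → f i ≡ nothing) → elements f ≡ []
  elements-empty {zero}  f f≗ = refl
  elements-empty {suc n} f f≗ rewrite f≗ zero = elements-empty (f ∘ suc) (f≗ ∘ suc)

  elements-three : ∀ {n} (f : Fin n → Maybe X) {i j k x y z} →
                   i ≢ j → i ≢ k → j ≢ k →
                   f i ≡ just x → f j ≡ just y → f k ≡ just z →
                   (∀ l → l ≢ i → l ≢ j → l ≢ k → f l ≡ nothing) →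
                   elements f ↭ x ∷ y ∷ z ∷ []
  elements-three f {i} {j} {k} {x} {y} {z} i≢j i≢k j≢k fi fj fk rest =
    ↭-trans (elements-remove f i fi)
      (prep x (↭-trans (elements-remove f₁ j (trans (updateAt-minimal j i f (i≢j ∘ sym)) fj))
        (prep y (↭-trans (elements-remove f₂ k
            (trans (updateAt-minimal k j f₁ (j≢k ∘ sym)) (trans (updateAt-minimal k i f (i≢k ∘ sym)) fk)))
          (subst (λ l → z ∷ l ↭ z ∷ []) (sym (elements-empty f₃ empty)) ↭-refl)))))
    where
    f₁ = updateAt f i (const nothing)
    f₂ = updateAt f₁ j (const nothing)
    f₃ = updateAt f₂ k (const nothing)
    empty : ∀ l → f₃ l ≡ nothing
    empty l with l ≟ k
    ... | yes refl = updateAt-updates k f₂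
    ... | no  l≢k  with l ≟ j
    ...   | yes refl = trans (updateAt-minimal l k f₂ l≢k) (updateAt-updates l f₁)
    ...   | no  l≢j  with l ≟ i
    ...     | yes refl = trans (updateAt-minimal l k f₂ l≢k)
                           (trans (updateAt-minimal l j f₁ l≢j) (updateAt-updates l f))
    ...     | no  l≢i  = trans (updateAt-minimal l k f₂ l≢k)
                           (trans (updateAt-minimal l j f₁ l≢j)
                             (trans (updateAt-minimal l i f l≢i) (rest l l≢i l≢j l≢k)))

-- Cyclically 3-diagonal arrays

module Band {X : Set} (p : ℕ) (2≤p : 2 ≤ p) (mid low upp : Fin (suc p) → X) where

  next prev : Fin (suc p) → Fin (suc p)
  next = shift 1
  prev = shift p

  next-prev : ∀ c → next (prev c) ≡ c
  next-prev c = trans (shift-∘ 1 p c) (shift-period c)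

  prev-next : ∀ c → prev (next c) ≡ c
  prev-next c = trans (shift-∘ p 1 c) (trans (cong (λ k → shift k c) (+-comm p 1)) (shift-period c))

  next≢ : ∀ c → next c ≢ c
  next≢ c = shift-moves c z<s (s≤s (<⇒≤ 2≤p))

  -- Order at least 3 enters here: it keeps the two outer diagonals from coinciding.
  next-next≢ : ∀ c → next (next c) ≢ c
  next-next≢ c = shift-moves c z<s (s≤s 2≤p) ∘ trans (sym (shift-∘ 1 1 c))

  next⇒prev : ∀ {r c} → c ≡ next r → r ≡ prev c
  next⇒prev refl = sym (prev-next _)

  prev⇒next : ∀ {r c} → r ≡ prev c → c ≡ next r
  prev⇒next refl = sym (next-prev _)

  prev≢ : ∀ c → prev c ≢ c
  prev≢ c eq = next≢ c (sym (prev⇒next (sym eq)))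

  next≢prev : ∀ c → next c ≢ prev c
  next≢prev c eq = next-next≢ c (sym (prev⇒next eq))

  -- The lower diagonal is indexed by rows and the upper one by columns. Row `c` and column `c` then
  -- both use the index pair `c`, `next c` on the outer diagonals, only in opposite order, so one
  -- condition on cyclically adjacent terms serves both.
  band : PFArray X (suc p)
  band r c with r ≟ c | r ≟ next c | c ≟ next r
  ... | yes _ | _     | _     = just (mid r)
  ... | no  _ | yes _ | _     = just (low r)
  ... | no  _ | no  _ | yes _ = just (upp c)
  ... | no  _ | no  _ | no  _ = nothing

  band-mid : ∀ r → band r r ≡ just (mid r)
  band-mid r with r ≟ r
  ... | yes _   = refl
  ... | no  r≢r = contradiction refl r≢r

  band-low : ∀ {r c} → r ≡ next c → band r c ≡ just (low r)
  band-low {r} {c} eq with r ≟ c | r ≟ next c | c ≟ next r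
  ... | yes r≡c | _      | _ = contradiction (trans (sym eq) r≡c) (next≢ c)
  ... | no  _   | yes _  | _ = refl
  ... | no  _   | no neq | _ = contradiction eq neq

  band-upp : ∀ {r c} → c ≡ next r → band r c ≡ just (upp c)
  band-upp {r} {c} eq with r ≟ c | r ≟ next c | c ≟ next r
  ... | yes r≡c | _       | _      = contradiction (trans (sym eq) (sym r≡c)) (next≢ r)
  ... | no  _   | yes eq′ | _      = contradiction (trans (cong next (sym eq)) (sym eq′)) (next-next≢ r)
  ... | no  _   | no  _   | yes _  = refl
  ... | no  _   | no  _   | no neq = contradiction eq neq

  band-empty : ∀ {r c} → r ≢ c → r ≢ next c → c ≢ next r → band r c ≡ nothing
  band-empty {r} {c} ≢mid ≢low ≢upp with r ≟ c | r ≟ next c | c ≟ next r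
  ... | yes eq | _      | _      = contradiction eq ≢mid
  ... | no  _  | yes eq | _      = contradiction eq ≢low
  ... | no  _  | no  _  | yes eq = contradiction eq ≢upp
  ... | no  _  | no  _  | no  _  = refl

  band-row : ∀ r → elements (λ c → band r c) ↭ mid r ∷ low r ∷ upp (next r) ∷ []
  band-row r = elements-three (band r)
    (prev≢ r ∘ sym) (next≢ r ∘ sym) (next≢prev r ∘ sym)
    (band-mid r) (band-low (sym (next-prev r))) (band-upp refl)
    (λ c ≢r ≢prev ≢next → band-empty (≢r ∘ sym) (≢prev ∘ next⇒prev) ≢next)

  band-column : ∀ c → elements (λ r → band r c) ↭ mid c ∷ low (next c) ∷ upp c ∷ []
  band-column c = elements-three (λ r → band r c)
    (next≢ c ∘ sym) (prev≢ c ∘ sym) (next≢prev c)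
    (band-mid c) (band-low refl) (band-upp (sym (next-prev c)))
    (λ r ≢c ≢next ≢prev → band-empty ≢c ≢next (≢prev ∘ next⇒prev))

  band-lines : (P : List X → Set) → (∀ {xs ys} → xs ↭ ys → P ys → P xs) →
               (∀ c → P (mid c ∷ low c ∷ upp (next c) ∷ [])) →
               (∀ c → P (mid c ∷ low (next c) ∷ upp c ∷ [])) →
               EveryLine P band
  band-lines P resp row column =
    (λ r → resp (band-row r) (row r)) , (λ c → resp (band-column c) (column c))

  band-isCyclicallyDiagonal : IsCyclicallyDiagonal 3 band
  -- Modulo `suc p` the shift by `p` is the shift by -1, so the diagonals starting at `p` are the
  -- upper, the main and the lower one.
  band-isCyclicallyDiagonal = s≤s 2≤p , p , λ r c → mk⇔ (to r c) (from r c)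
    where
    p+0 : ∀ c → shift (p + 0) c ≡ prev c
    p+0 c = cong (λ k → shift k c) (+-identityʳ p)

    p+1 : ∀ c → shift (p + 1) c ≡ c
    p+1 c = trans (cong (λ k → shift k c) (+-comm p 1)) (shift-period c)

    p+2 : ∀ c → shift (p + 2) c ≡ next c
    p+2 c = trans (cong (λ k → shift k c) (+-suc p 1))
      (trans (sym (shift-∘ (suc p) 1 c)) (shift-period (next c)))

    to : ∀ r c → Is-just (band r c) → ∃ λ (s : Fin 3) → OnDiagonal (p + toℕ s) r c
    to r c filled with r ≟ c | r ≟ next c | c ≟ next r | filled
    ... | yes eq | _      | _      | _  = suc zero , trans eq (sym (p+1 c))
    ... | no  _  | yes eq | _      | _  = suc (suc zero) , trans eq (sym (p+2 c))
    ... | no  _  | no  _  | yes eq | _  = zero , trans (next⇒prev eq) (sym (p+0 c))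
    ... | no  _  | no  _  | no  _  | ()

    from : ∀ r c → (∃ λ (s : Fin 3) → OnDiagonal (p + toℕ s) r c) → Is-just (band r c)
    from r c (zero , eq) = subst Is-just (sym (band-upp (prev⇒next (trans eq (p+0 c))))) (just tt)
    from r c (suc zero , eq) with trans eq (p+1 c)
    ... | refl = subst Is-just (sym (band-mid r)) (just tt)
    from r c (suc (suc zero) , eq) = subst Is-just (sym (band-low (trans eq (p+2 c)))) (just tt)

-- The alternating sequence

-- The multipliers of the outer diagonals, increased by m so as to stay in ℕ.
zigzag : ℕ → ℕ → ℕ
zigzag m 0             = m
zigzag m 1             = 0
zigzag m (suc (suc c)) = suc (zigzag m c)

zigzag-even : ∀ m j → zigzag m (j * 2) ≡ j + m
zigzag-even m zero    = refl
zigzag-even m (suc j) = cong suc (zigzag-even m j)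

zigzag-odd : ∀ m j → zigzag m (suc (j * 2)) ≡ j
zigzag-odd m zero    = refl
zigzag-odd m (suc j) = cong suc (zigzag-odd m j)

-- Moving the window one place replaces its first term by the term two places later, which is larger
-- by one. Since both terms are raised by `m`, the multipliers themselves add up to c - m.
zigzag-adjacent : ∀ m c → zigzag m c + zigzag m (suc c) ≡ c + m
zigzag-adjacent m zero    = +-identityʳ m
zigzag-adjacent m (suc c) = begin
  zigzag m (suc c) + suc (zigzag m c)   ≡⟨ +-suc _ _ ⟩
  suc (zigzag m (suc c) + zigzag m c)   ≡⟨ cong suc (+-comm (zigzag m (suc c)) _) ⟩
  suc (zigzag m c + zigzag m (suc c))   ≡⟨ cong suc (zigzag-adjacent m c) ⟩
  suc (c + m)                           ∎
  where open ≡-Reasoning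

-- The doubled bound `twice` holds for both parities at once and grows by two on each side in every
-- recursive step.
zigzag-≤ : ∀ m {c} → c ≤ m * 2 → zigzag m c ≤ m * 2
zigzag-≤ m {c} c≤2m = *-cancelʳ-≤ _ _ 2 (begin
  zigzag m c * 2   ≤⟨ twice c ⟩
  c + m * 2        ≤⟨ +-monoˡ-≤ (m * 2) c≤2m ⟩
  m * 2 + m * 2    ≡⟨ m+m≡m*2 (m * 2) ⟩
  m * 2 * 2        ∎)
  where
  open ≤-Reasoning
  twice : ∀ c → zigzag m c * 2 ≤ c + m * 2
  twice 0             = ≤-refl
  twice 1             = z≤n
  twice (suc (suc c)) = s≤s (s≤s (twice c))

-- Even positions take the values m, ..., 2m and odd positions the values 0, ..., m - 1.
zigzag-surjective : ∀ m {u} → u ≤ m * 2 → ∃[ c ] c ≤ m * 2 × zigzag m c ≡ u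
zigzag-surjective m {u} u≤2m with ≤-total m u
... | inj₁ m≤u = (u ∸ m) * 2 , *-monoˡ-≤ 2 u∸m≤m , trans (zigzag-even m (u ∸ m)) (m∸n+n≡m m≤u)
  where
  u∸m≤m : u ∸ m ≤ m
  u∸m≤m = m≤n+o⇒m∸n≤o u m (≤-trans u≤2m (≤-reflexive (sym (m+m≡m*2 m))))
... | inj₂ u≤m with m≤n⇒m<n∨m≡n u≤m
...   | inj₁ u<m  = suc (u * 2) , <⇒≤ (*-monoˡ-≤ 2 u<m) , zigzag-odd m u
...   | inj₂ refl = 0 , z≤n , refl

-- Balanced representatives modulo an odd number

module Rotation {v : ℕ} .{{_ : NonZero v}} (h : ℕ) (v≡1+2h : v ≡ suc (h + h)) where

  open ≡-Reasoning

  -- The residue of w - h: the interval 0, …, 2h stands for -h, …, h.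
  rotate : ℕ → Fin v
  rotate w = (w + suc h) mod v

  -- The two offsets `h` and `suc h` add up to `v`, a full turn.
  rotate-surjective : ∀ y → rotate ((toℕ y + h) % v) ≡ y
  rotate-surjective y = toℕ-injective (begin
    toℕ (rotate ((toℕ y + h) % v))     ≡⟨ toℕ-mod _ v ⟩
    ((toℕ y + h) % v + suc h) % v      ≡⟨ %-congˡ (+-comm _ (suc h)) ⟩
    (suc h + (toℕ y + h) % v) % v      ≡⟨ [m+n%d]%d≡[m+n]%d (suc h) (toℕ y + h) v ⟩
    (suc h + (toℕ y + h)) % v          ≡⟨ %-congˡ (regroup h (toℕ y)) ⟩
    (toℕ y + suc (h + h)) % v          ≡⟨ cong (λ k → (toℕ y + k) % v) v≡1+2h ⟨
    (toℕ y + v) % v                    ≡⟨ [m+n]%n≡m%n (toℕ y) v ⟩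
    toℕ y % v                          ≡⟨ m<n⇒m%n≡m (toℕ<n y) ⟩
    toℕ y                              ∎)
    where
    regroup : ∀ h y → suc h + (y + h) ≡ y + suc (h + h)
    regroup = solve-∀

  v/2≡h : v / 2 ≡ h
  v/2≡h = begin
    v / 2              ≡⟨ cong (_/ 2) (trans v≡1+2h (cong suc (m+m≡m*2 h))) ⟩
    (1 + h * 2) / 2    ≡⟨ +-distrib-/-∣ʳ 1 {h * 2} {2} (n∣m*n h) ⟩
    h * 2 / 2          ≡⟨ m*n/n≡m h 2 ⟩
    h                  ∎

  signed-small : ∀ (x : Fin v) → toℕ x ≤ h → signed x ≡ + toℕ x
  signed-small x x≤h with toℕ x ≤ᵇ v / 2 | ≤ᵇ-reflects-≤ (toℕ x) (v / 2)
  ... | true  | _ = refl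
  ... | false | r = contradiction (≤-trans x≤h (≤-reflexive (sym v/2≡h))) (invert r)

  signed-large : ∀ (x : Fin v) → h < toℕ x → signed x ≡ toℕ x ℤ.⊖ v
  signed-large x h<x with toℕ x ≤ᵇ v / 2 | ≤ᵇ-reflects-≤ (toℕ x) (v / 2)
  ... | false | _ = refl
  ... | true  | r = contradiction (≤-trans (invert r) (≤-reflexive v/2≡h)) (<⇒≱ h<x)

  -- For `h ≤ w` the sum `w + suc h` wraps around once and leaves the small residue w - h. For
  -- `w < h` it does not wrap and exceeds `h`, so `signed` subtracts `v`, which gives w - h again.
  signed-rotate : ∀ {w} → w ≤ h + h → signed (rotate w) ≡ w ℤ.⊖ h
  signed-rotate {w} w≤2h with ≤-<-connex h w
  ... | inj₁ h≤w = begin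
    signed (rotate w)     ≡⟨ signed-small (rotate w) (≤-trans (≤-reflexive value) w∸h≤h) ⟩
    + toℕ (rotate w)      ≡⟨ cong +_ value ⟩
    + (w ∸ h)             ≡⟨ ℤ.⊖-≥ h≤w ⟨
    w ℤ.⊖ h               ∎
    where
    w∸h≤h : w ∸ h ≤ h
    w∸h≤h = m≤n+o⇒m∸n≤o w h w≤2h
    w∸h<v : w ∸ h < v
    w∸h<v = subst (w ∸ h <_) (sym v≡1+2h) (s≤s (≤-trans w∸h≤h (m≤m+n h h)))
    regroup : ∀ d h → d + h + suc h ≡ d + suc (h + h)
    regroup = solve-∀
    value : toℕ (rotate w) ≡ w ∸ h
    value = begin
      toℕ (rotate w)               ≡⟨ toℕ-mod _ v ⟩
      (w + suc h) % v              ≡⟨ cong (λ k → (k + suc h) % v) (m∸n+n≡m h≤w) ⟨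
      (w ∸ h + h + suc h) % v      ≡⟨ %-congˡ (regroup (w ∸ h) h) ⟩
      (w ∸ h + suc (h + h)) % v    ≡⟨ cong (λ k → (w ∸ h + k) % v) v≡1+2h ⟨
      (w ∸ h + v) % v              ≡⟨ [m+n]%n≡m%n (w ∸ h) v ⟩
      (w ∸ h) % v                  ≡⟨ m<n⇒m%n≡m w∸h<v ⟩
      w ∸ h                        ∎
  ... | inj₂ w<h = begin
    signed (rotate w)
      ≡⟨ signed-large (rotate w) (≤-trans (m≤n+m (suc h) w) (≤-reflexive (sym value))) ⟩
    toℕ (rotate w) ℤ.⊖ v
      ≡⟨ cong₂ ℤ._⊖_ (trans value (+-comm w (suc h))) v≡1+2h ⟩
    (suc h + w) ℤ.⊖ (suc h + h)
      ≡⟨ ℤ.+-cancelˡ-⊖ (suc h) w h ⟩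
    w ℤ.⊖ h ∎
    where
    value : toℕ (rotate w) ≡ w + suc h
    value = trans (toℕ-mod _ v) (m<n⇒m%n≡m
      (subst₂ _<_ (+-comm (suc h) w) (sym v≡1+2h) (s≤s (+-monoʳ-< h w<h))))

  -- Each representative is its argument minus `h`, so a zero sum over ℤ turns into an equation
  -- between natural numbers.
  signed-rotate-sum : ∀ {a b c} → a ≤ h + h → b ≤ h + h → c ≤ h + h → a + b + c ≡ h + h + h →
                      sumℤ (map signed (rotate a ∷ rotate b ∷ rotate c ∷ [])) ≡ 0ℤ
  signed-rotate-sum {a} {b} {c} a≤ b≤ c≤ eq = begin
    signed (rotate a) ℤ.+ (signed (rotate b) ℤ.+ (signed (rotate c) ℤ.+ 0ℤ))
      ≡⟨ cong₂ ℤ._+_ (value a≤) (cong₂ ℤ._+_ (value b≤) (cong (ℤ._+ 0ℤ) (value c≤))) ⟩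
    + a ℤ.- + h ℤ.+ (+ b ℤ.- + h ℤ.+ (+ c ℤ.- + h ℤ.+ 0ℤ))
      ≡⟨ regroup (+ a) (+ b) (+ c) (+ h) ⟩
    + (a + b + c) ℤ.- + (h + h + h)
      ≡⟨ cong (λ s → + s ℤ.- + (h + h + h)) eq ⟩
    + (h + h + h) ℤ.- + (h + h + h)
      ≡⟨ ℤ.+-inverseʳ (+ (h + h + h)) ⟩
    0ℤ ∎
    where
    value : ∀ {w} → w ≤ h + h → signed (rotate w) ≡ + w ℤ.- + h
    value {w} w≤ = trans (signed-rotate w≤) (sym (ℤ.m-n≡m⊖n w h))
    regroup : ∀ a b c h → a ℤ.- h ℤ.+ (b ℤ.- h ℤ.+ (c ℤ.- h ℤ.+ 0ℤ)) ≡ a ℤ.+ b ℤ.+ c ℤ.- (h ℤ.+ h ℤ.+ h)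
    regroup = ℤ-Solver.solve-∀

-- Choice of signs modulo 7

PositiveResidue : ℕ → Set
PositiveResidue r = r ≡ 1 ⊎ r ≡ 2 ⊎ r ≡ 4

-- The numbers 1, 2, 4 are the nonzero squares modulo 7 and -1 is not a square, so the other nonzero
-- residues are their negatives. The 49 pairs are decided by evaluation.
residue-trichotomy : ∀ {a b} → a < 7 → b < 7 → (a + b) % 7 ≡ 0 →
                     a ≡ 0 ⊎ PositiveResidue a ⊎ PositiveResidue b
residue-trichotomy {a} {b} a<7 b<7 with toWitness {a? = check} tt (fromℕ< a<7) (fromℕ< b<7)
  where
  positive? : ∀ r → Dec (PositiveResidue r)
  positive? r = r ℕ.≟ 1 ⊎-dec r ℕ.≟ 2 ⊎-dec r ℕ.≟ 4
  check : Dec (∀ (a b : Fin 7) → (toℕ a + toℕ b) % 7 ≡ 0 →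
               toℕ a ≡ 0 ⊎ PositiveResidue (toℕ a) ⊎ PositiveResidue (toℕ b))
  check = all? λ a → all? λ b → (toℕ a + toℕ b) % 7 ℕ.≟ 0 →-dec
    (toℕ a ℕ.≟ 0 ⊎-dec positive? (toℕ a) ⊎-dec positive? (toℕ b))
... | checked rewrite toℕ-fromℕ< a<7 | toℕ-fromℕ< b<7 = checked

-- The array

module Construction (m : ℕ) (2≤2m : 2 ≤ m * 2) where

  open ≡-Reasoning

  n h v : ℕ
  n = suc (m * 2)
  -- This is (v - 1)/2 for v = 7(2m + 1).
  h = 3 + m * 7
  v = modulus n n 3

  v≡1+2h : v ≡ suc (h + h)
  v≡1+2h = identity m
    where
    identity : ∀ m → 2 * suc (m * 2) * 3 + suc (m * 2) ≡ suc (3 + m * 7 + (3 + m * 7))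
    identity = solve-∀

  v≡n*7 : v ≡ n * 7
  v≡n*7 = identity n
    where
    identity : ∀ n → 2 * n * 3 + n ≡ n * 7
    identity = solve-∀

  7∣v : 7 ∣ v
  7∣v = divides n v≡n*7

  open Rotation {v} h v≡1+2h
  open Cyclic v using (⊖_)

  -- The constants 0, 4, 5 are -3, 1, 2 raised by 3. Subtracting `h` leaves the integers 7(m - c) -
  -- 3 on the main diagonal and 7(z - m) + 1, 7(z - m) + 2 on the outer ones, where z is the
  -- `zigzag` value.
  mid low upp : Fin n → Fin v
  mid c = rotate ((m * 2 ∸ toℕ c) * 7)
  low r = rotate (4 + zigzag m (toℕ r) * 7)
  upp c = rotate (5 + zigzag m (toℕ c) * 7)

  open Band (m * 2) 2≤2m mid low upp public

  -- Away from the end this is `zigzag-adjacent`. At the wrap the last value 2m meets the first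
  -- value m, and their sum 3m continues the same progression.
  zigzag-next : ∀ c → zigzag m (toℕ c) + zigzag m (toℕ (next c)) ≡ toℕ c + m
  zigzag-next c with m≤n⇒m<n∨m≡n (s≤s⁻¹ (toℕ<n c))
  ... | inj₁ c<2m = trans
    (cong (λ k → zigzag m (toℕ c) + zigzag m k)
      (trans (toℕ-mod (suc (toℕ c)) n) (m<n⇒m%n≡m {n = n} (s≤s c<2m))))
    (zigzag-adjacent m (toℕ c))
  ... | inj₂ c≡2m = begin
    zigzag m (toℕ c) + zigzag m (toℕ (next c))  ≡⟨ cong₂ (λ k l → zigzag m k + zigzag m l) c≡2m next≡0 ⟩
    zigzag m (m * 2) + m                        ≡⟨ cong (_+ m) (zigzag-even m m) ⟩
    m + m + m                                   ≡⟨ cong (_+ m) (m+m≡m*2 m) ⟩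
    m * 2 + m                                   ≡⟨ cong (_+ m) c≡2m ⟨
    toℕ c + m                                   ∎
    where
    next≡0 : toℕ (next c) ≡ 0
    next≡0 = trans (toℕ-mod (suc (toℕ c)) n) (trans (%-congˡ {o = n} (cong suc c≡2m)) (n%n≡0 n))

  -- The constants 0, 4, 5 add up to 9 and the raised multipliers to 3m, as in three copies of `h`.
  line-sum : ∀ {a c u u′} → a + c ≡ m * 2 → u + u′ ≡ c + m →
             a * 7 + (4 + u * 7) + (5 + u′ * 7) ≡ h + h + h
  line-sum {a} {c} {u} {u′} a+c u+u′ = begin
    a * 7 + (4 + u * 7) + (5 + u′ * 7)  ≡⟨ gather a u u′ ⟩
    9 + (a + (u + u′)) * 7              ≡⟨ cong (λ s → 9 + (a + s) * 7) u+u′ ⟩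
    9 + (a + (c + m)) * 7               ≡⟨ cong (λ s → 9 + s * 7) (+-assoc a c m) ⟨
    9 + (a + c + m) * 7                 ≡⟨ cong (λ s → 9 + (s + m) * 7) a+c ⟩
    9 + (m * 2 + m) * 7                 ≡⟨ spread m ⟩
    h + h + h                           ∎
    where
    gather : ∀ a u u′ → a * 7 + (4 + u * 7) + (5 + u′ * 7) ≡ 9 + (a + (u + u′)) * 7
    gather = solve-∀
    spread : ∀ m → 9 + (m * 2 + m) * 7 ≡ 3 + m * 7 + (3 + m * 7) + (3 + m * 7)
    spread = solve-∀

  entry-≤ : ∀ {ρ u} → ρ ≤ 6 → u ≤ m * 2 → ρ + u * 7 ≤ h + h
  entry-≤ ρ≤6 u≤2m = ≤-trans (+-mono-≤ ρ≤6 (*-monoˡ-≤ 7 u≤2m)) (≤-reflexive (identity m))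
    where
    identity : ∀ m → 6 + m * 2 * 7 ≡ 3 + m * 7 + (3 + m * 7)
    identity = solve-∀

  zigzag-toℕ-≤ : ∀ (c : Fin n) → zigzag m (toℕ c) ≤ m * 2
  zigzag-toℕ-≤ c = zigzag-≤ m (s≤s⁻¹ (toℕ<n c))

  triple-sum : ∀ c r s → zigzag m (toℕ r) + zigzag m (toℕ s) ≡ toℕ c + m →
               sumℤ (map signed (mid c ∷ low r ∷ upp s ∷ [])) ≡ 0ℤ
  triple-sum c r s eq = signed-rotate-sum
    (entry-≤ {0} z≤n (m∸n≤m (m * 2) (toℕ c)))
    (entry-≤ (m≤m+n 4 2) (zigzag-toℕ-≤ r))
    (entry-≤ (m≤m+n 5 1) (zigzag-toℕ-≤ s))
    (line-sum {u = zigzag m (toℕ r)} (m∸n+n≡m (s≤s⁻¹ (toℕ<n c))) eq)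

  band-isInteger : IsInteger band
  band-isInteger = band-lines (λ xs → sumℤ (map signed xs) ≡ 0ℤ)
    (λ xs↭ys eq → trans (sumℤ-↭ (map⁺ signed xs↭ys)) eq)
    (λ c → triple-sum c c (next c) (zigzag-next c))
    (λ c → triple-sum c (next c) c (trans (+-comm (zigzag m (toℕ (next c))) _) (zigzag-next c)))

  at : ∀ {c} → c ≤ m * 2 → Fin n
  at c≤2m = fromℕ< (s≤s c≤2m)

  -- The remainder `ρ` selects the diagonal. On the outer ones `zigzag-surjective` supplies the
  -- position of `u`; on the main one it is 2m - u.
  rotate-entry-appears : ∀ {ρ u} → u ≤ m * 2 → ρ ≡ 4 ⊎ ρ ≡ 5 ⊎ ρ ≡ 0 → Appears (rotate (ρ + u * 7)) band
  rotate-entry-appears {u = u} u≤2m (inj₁ refl) with zigzag-surjective m u≤2m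
  ... | c , c≤2m , refl = at c≤2m , prev (at c≤2m) ,
    trans (band-low (sym (next-prev (at c≤2m))))
      (cong (λ k → just (rotate (4 + zigzag m k * 7))) (toℕ-fromℕ< (s≤s c≤2m)))
  rotate-entry-appears {u = u} u≤2m (inj₂ (inj₁ refl)) with zigzag-surjective m u≤2m
  ... | c , c≤2m , refl = prev (at c≤2m) , at c≤2m ,
    trans (band-upp (sym (next-prev (at c≤2m))))
      (cong (λ k → just (rotate (5 + zigzag m k * 7))) (toℕ-fromℕ< (s≤s c≤2m)))
  rotate-entry-appears {u = u} u≤2m (inj₂ (inj₂ refl)) = c , c ,
    trans (band-mid c) (cong (λ k → just (rotate (k * 7)))
      (trans (cong (m * 2 ∸_) (toℕ-fromℕ< (s≤s (m∸n≤m (m * 2) u)))) (m∸[m∸n]≡n u≤2m)))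
    where
    c : Fin n
    c = at (m∸n≤m (m * 2) u)

  -- The preimage `w` of `y` under `rotate` is divided by 7: its quotient is a raised multiplier,
  -- and since `h` is 3 modulo 7 the residues 1, 2, 4 of `y` become the remainders 4, 5, 0 of `w`.
  positive-appears : ∀ y → PositiveResidue (toℕ y % 7) → Appears y band
  positive-appears y positive = subst (λ x → Appears x band)
    (trans (cong rotate (sym (m≡m%n+[m/n]*n w 7))) (rotate-surjective y))
    (rotate-entry-appears w/7≤2m (shift-residue positive))
    where
    w = (toℕ y + h) % v
    w/7≤2m : w / 7 ≤ m * 2
    w/7≤2m = s≤s⁻¹ (m<n*o⇒m/o<n (subst (w <_) v≡n*7 (m%n<n (toℕ y + h) v)))
    w%7 : w % 7 ≡ (3 + toℕ y % 7) % 7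
    w%7 = begin
      w % 7                        ≡⟨ m∣n⇒o%n%m≡o%m 7 v (toℕ y + h) 7∣v ⟩
      (toℕ y + h) % 7              ≡⟨ %-congˡ (regroup (toℕ y) m) ⟩
      (3 + toℕ y + m * 7) % 7      ≡⟨ [m+kn]%n≡m%n (3 + toℕ y) m 7 ⟩
      (3 + toℕ y) % 7              ≡⟨ [m+n%d]%d≡[m+n]%d 3 (toℕ y) 7 ⟨
      (3 + toℕ y % 7) % 7          ∎
      where
      regroup : ∀ y m → y + (3 + m * 7) ≡ 3 + y + m * 7
      regroup = solve-∀
    shift-residue : PositiveResidue (toℕ y % 7) → w % 7 ≡ 4 ⊎ w % 7 ≡ 5 ⊎ w % 7 ≡ 0
    shift-residue = Sum.map at-residue (Sum.map at-residue at-residue)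
      where
      at-residue : ∀ {r} → toℕ y % 7 ≡ r → w % 7 ≡ (3 + r) % 7
      at-residue eq = trans w%7 (cong (λ r → (3 + r) % 7) eq)

  -- As 7 divides `v`, the reduction modulo `v` inside `⊖ x` is invisible modulo 7.
  opposite-residues : ∀ (x : Fin v) → (toℕ x % 7 + toℕ (⊖ x) % 7) % 7 ≡ 0
  opposite-residues x = begin
    (toℕ x % 7 + toℕ (⊖ x) % 7) % 7        ≡⟨ cong (λ r → (toℕ x % 7 + r % 7) % 7) (toℕ-mod (v ∸ toℕ x) v) ⟩
    (toℕ x % 7 + (v ∸ toℕ x) % v % 7) % 7  ≡⟨ cong (λ r → (toℕ x % 7 + r) % 7)
                                                (m∣n⇒o%n%m≡o%m 7 v (v ∸ toℕ x) 7∣v) ⟩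
    (toℕ x % 7 + (v ∸ toℕ x) % 7) % 7      ≡⟨ %-distribˡ-+ (toℕ x) (v ∸ toℕ x) 7 ⟨
    (toℕ x + (v ∸ toℕ x)) % 7              ≡⟨ %-congˡ (m+[n∸m]≡n (<⇒≤ (toℕ<n x))) ⟩
    v % 7                                  ≡⟨ n∣m⇒m%n≡0 v 7 7∣v ⟩
    0                                      ∎

  band-isRelativeHeffter : IsRelativeHeffter n n 3 band
  band-isRelativeHeffter = record
    { 3≤k        = ≤-refl
    ; k≤n        = s≤s 2≤2m
    ; t∣2nk      = ∣-trans (n∣m*n 2) (m∣m*n 3)
    ; J          = multiples 7 v
    ; J-subgroup = multiples-isSubgroup 7 7∣v
    ; J-order    = trans (cong (λ u → ∣ multiples 7 u ∣) v≡n*7) (∣multiples-7∣ n)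
    ; filled     = band-lines (λ xs → length xs ≡ 3)
                     (λ xs↭ys eq → trans (↭-length xs↭ys) eq) (λ _ → refl) (λ _ → refl)
    -- A residue divisible by 7 would lie in `J`; otherwise `x` or its negative is 1, 2 or 4 modulo
    -- 7 and so appears.
    ; support    = λ x x∉J → Sum.map (positive-appears x) (positive-appears (⊖ x))
                     ([ (λ x%7≡0 → contradiction (∈-multiples⁺ 7 (m%n≡0⇒n∣m (toℕ x) 7 x%7≡0)) x∉J)
                       , (λ p → p) ]′
                       (residue-trichotomy (m%n<n (toℕ x) 7) (m%n<n (toℕ (⊖ x)) 7) (opposite-residues x)))
    ; zero-sum   = (λ r → sumℤ≡0⇒sum≡𝟘 (elements (λ c → band r c)) (proj₁ band-isInteger r))
                 , (λ c → sumℤ≡0⇒sum≡𝟘 (elements (λ r → band r c)) (proj₂ band-isInteger c))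
    }

-- Passage to arbitrary odd orders

odd⇒1+2m : ∀ n → ¬ (2 ∣ n) → ∃[ m ] n ≡ suc (m * 2)
odd⇒1+2m n 2∤n with n % 2 in eq | m%n<n n 2
... | 0           | _                = contradiction (m%n≡0⇒n∣m n 2 eq) 2∤n
... | 1           | _                = n / 2 , trans (m≡m%n+[m/n]*n n 2) (cong (_+ n / 2 * 2) eq)
... | suc (suc _) | s≤s (s≤s ())

proposition4p1 : ∀ (n : ℕ) → n ≥ 3 → ¬ (2 ∣ n) →
    Σ (PFArray (Fin (modulus n n 3)) n) λ A →
    IsRelativeHeffter n n 3 A × IsInteger A × IsCyclicallyDiagonal 3 A
proposition4p1 n n≥3 2∤n with odd⇒1+2m n 2∤n
... | m , refl = band , band-isRelativeHeffter , band-isInteger , band-isCyclicallyDiagonal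
  where
  open Construction m (s≤s⁻¹ n≥3)
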